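{- Let $U=\{1,\dots,n\}$ with distance function $d$ and continuation probabilities $p_i\in[a,b]$ for all $i\in U$, where $0<a\le b<1$. Let $\tau$ be an integer with $2\le\tau\le n$. Then the SB$\tau$I algorithm provides a $\frac{a^\tau(1-b)(1-b^{\tau-1})}{a^\tau(1-b)+b^{\tau+1}}$-approximation guarantee for MaxSSD. That is, for any ordering $O$ output by the algorithm, $$\mathcal{S}_+(O)\ \ge\ \frac{a^\tau(1-b)(1-b^{\tau-1})}{a^\tau(1-b)+b^{\tau+1}}\,\max_{O'}\mathcal{S}_+(O'),$$ the maximum being over all orderings $O'$ of $U$.
   Context: The distance function $d:U\times U\to\mathbb{R}_{\ge0}$ is symmetric with $d(i,i)=0$. For an ordering $O=(\pi(1),\dots,\pi(n))$ of $U$ let $O_k=(\pi(1),\dots,\pi(k))$, $p_{O_k}=\prod_{t=1}^kp_{\pi(t)}$ and $d(x,O_i)=\sum_{t=1}^id(x,\pi(t))$. The sequential sum diversity of $O$ is $\mathcal{S}_+(O)=\sum_{i=1}^{n-1}p_{O_{i+1}}\,d(\pi(i+1),O_i)$ (the expected sum of distances over unordered pairs of accepted items, when a user scans the items in order, accepts item $\pi(i)$ and continues with probability $p_{\pi(i)}$, and otherwise quits). MaxSSD asks for an ordering of $U$ maximizing $\mathcal{S}_+$. For a sequence $O_\tau$ of $\tau$ distinct items put $\mathcal{S}_+(O_\tau)=\sum_{i=1}^{\tau-1}p_{O_{i+1}}\,d(\pi(i+1),O_i)$. The SB$\tau$I algorithm chooses a sequence $O_\tau$ of $\tau$ distinct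 items maximizing $\mathcal{S}_+(O_\tau)$ over all sequences of $\tau$ distinct items of $U$, and then extends it to an ordering of all of $U$ by appending the remaining items in an arbitrary order. -}

module Defs where

open import Level using (_⊔_; suc)
open import Algebra.Apartness.Bundles using (HeytingField)
open import Algebra.Bundles using (CommutativeRing)
open import Data.Fin.Base using (Fin)
open import Data.List.Base using (List; []; _∷_; _++_; _∷ʳ_; length; map; foldr; allFin)
open import Data.List.Relation.Binary.Permutation.Propositional using (_↭_)
open import Data.List.Relation.Unary.Unique.Propositional using (Unique)
open import Data.Nat.Base as ℕ using (ℕ; zero)
open import Data.Product.Base using (_×_; _,_; proj₁; ∃-syntax)
open import Data.Sum.Base using (_⊎_; inj₁; inj₂)
open import Function.Bundles using (_⇔_; Equivalence)
open import Relation.Binary.Core using (Rel)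
open import Relation.Binary.PropositionalEquality.Core using (_≡_)
open import Relation.Binary.Structures using (IsStrictPartialOrder)
open import Relation.Nullary.Negation using (¬_; contradiction)
import Algebra.Properties.Semiring.Exp as SemiringExp

-- The library has no real numbers, so the scalars range over an arbitrary
-- ordered field. The axioms are chosen so that ℝ is an instance both
-- classically (_#_ being the negation of _≈_) and constructively: _<_ is not
-- assumed decidable, and its cotransitivity follows from that of _#_.
record OrderedField c ℓ₁ ℓ₂ : Set (suc (c ⊔ ℓ₁ ⊔ ℓ₂)) where
  field
    heytingField : HeytingField c ℓ₁ ℓ₂

  open HeytingField heytingField public

  infix 4 _<_ _≤_

  field
    _<_                  : Rel Carrier ℓ₂
    isStrictPartialOrder : IsStrictPartialOrder _≈_ _<_
    #⇔<⊎>                : ∀ x y → x # y ⇔ (x < y ⊎ y < x)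
    +-monoʳ-<            : ∀ z {x y} → x < y → z + x < z + y
    *-positive           : ∀ {x y} → 0# < x → 0# < y → 0# < x * y

  open IsStrictPartialOrder isStrictPartialOrder public
    using (<-respʳ-≈; <-respˡ-≈)
    renaming (irrefl to <-irrefl; trans to <-trans)

  _≤_ : Rel Carrier ℓ₂
  x ≤ y = ¬ (y < x)

  commutativeRing : CommutativeRing c ℓ₁
  commutativeRing = record { isCommutativeRing = isCommutativeRing }

  open CommutativeRing commutativeRing public using (ring; semiring)
  open SemiringExp semiring public using (_^_)

  -- #⇒invertible y#0 inverts y - 0#, which is ≈ to y but not syntactically y.
  infixl 7 _/_⟨_⟩
  _/_⟨_⟩ : ∀ x y → y # 0# → Carrier
  x / y ⟨ y#0 ⟩ = x * proj₁ (#⇒invertible y#0)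

module _ {c ℓ₁ ℓ₂} (F : OrderedField c ℓ₁ ℓ₂) where
  open OrderedField F

  private
    +-positive : ∀ {x y} → 0# < x → 0# < y → 0# < x + y
    +-positive {x} 0<x 0<y =
      <-trans 0<x (<-respˡ-≈ (+-identityʳ x) (+-monoʳ-< x 0<y))

    x<y⇒0<y-x : ∀ {x y} → x < y → 0# < y - x
    x<y⇒0<y-x {x} {y} x<y =
      <-respˡ-≈ (-‿inverseˡ x) (<-respʳ-≈ (+-comm (- x) y) (+-monoʳ-< (- x) x<y))

    <-≤-trans : ∀ {x y z} → x < y → y ≤ z → x < z
    <-≤-trans {x} {y} {z} x<y y≤z
      with #-cotrans (Equivalence.from (#⇔<⊎> x y) (inj₁ x<y)) z
    ... | inj₁ x#z with Equivalence.to (#⇔<⊎> x z) x#z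
    ...   | inj₁ x<z = x<z
    ...   | inj₂ z<x = contradiction (<-trans z<x x<y) y≤z
    <-≤-trans {x} {y} {z} x<y y≤z
        | inj₂ z#y with Equivalence.to (#⇔<⊎> z y) z#y
    ...   | inj₁ z<y = contradiction z<y y≤z
    ...   | inj₂ y<z = <-trans x<y y<z

    ^-positive : ∀ {x} → 0# < 1# → 0# < x → ∀ k → 0# < x ^ k
    ^-positive 0<1 0<x zero      = 0<1
    ^-positive 0<1 0<x (ℕ.suc k) = *-positive 0<x (^-positive 0<1 0<x k)

  denominator#0 : ∀ {a b} → 0# < a → a ≤ b → b < 1# → ∀ τ →
                  a ^ τ * (1# - b) + b ^ (τ ℕ.+ 1) # 0#
  denominator#0 {a} {b} 0<a a≤b b<1 τ =
    #-sym (Equivalence.from (#⇔<⊎> _ _) (inj₁ (+-positive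
      (*-positive (^-positive 0<1 0<a τ) (x<y⇒0<y-x b<1))
      (^-positive 0<1 0<b (τ ℕ.+ 1)))))
    where
    0<b = <-≤-trans 0<a a≤b
    0<1 = <-trans 0<b b<1

  record IsDistance {n} (d : Fin n → Fin n → Carrier) : Set (c ⊔ ℓ₁ ⊔ ℓ₂) where
    field
      nonNegative : ∀ i j → 0# ≤ d i j
      symmetric   : ∀ i j → d i j ≈ d j i
      diagonal    : ∀ i → d i i ≈ 0#

  module MaxSSD {n} (d : Fin n → Fin n → Carrier) (p : Fin n → Carrier) where

    -- p_{O_k}, for the prefix O_k given as a list
    p[_] : List (Fin n) → Carrier
    p[ xs ] = foldr _*_ 1# (map p xs)

    -- d(x, O_i), for the prefix O_i given as a list
    d[_,_] : Fin n → List (Fin n) → Carrier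
    d[ x , xs ] = foldr _+_ 0# (map (d x) xs)

    -- sumFrom O_i (π(i+1) , π(i+2) , …) is the sum of the terms
    -- p_{O_{j+1}} d(π(j+1), O_j) with j ≥ i.
    sumFrom : List (Fin n) → List (Fin n) → Carrier
    sumFrom prefix []       = 0#
    sumFrom prefix (x ∷ xs) =
      p[ prefix ∷ʳ x ] * d[ x , prefix ] + sumFrom (prefix ∷ʳ x) xs

    S₊ : List (Fin n) → Carrier
    S₊ []       = 0#
    S₊ (x ∷ xs) = sumFrom (x ∷ []) xs

    IsOrdering : List (Fin n) → Set
    IsOrdering O = O ↭ allFin n

    IsSequence : ℕ → List (Fin n) → Set
    IsSequence τ s = length s ≡ τ × Unique s

    IsBestSequence : ℕ → List (Fin n) → Set ℓ₂
    IsBestSequence τ s = IsSequence τ s × (∀ t → IsSequence τ t → S₊ t ≤ S₊ s)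

    -- SBτI is nondeterministic (ties, and the order of the appended items);
    -- this relation holds of exactly its possible outputs.
    SBτIOutput : ℕ → List (Fin n) → Set ℓ₂
    SBτIOutput τ O =
      IsOrdering O × ∃[ s ] ∃[ rest ] (O ≡ s ++ rest × IsBestSequence τ s)

    -- S₊ O ≥ α · max S₊, the maximum being over the (finitely many) orderings:
    -- α · S₊ O′ is bounded by S₊ O for each of them, in particular for an
    -- optimal one. This form does not need the order to be decidable.
    IsApproximation : Carrier → List (Fin n) → Set ℓ₂
    IsApproximation α O = ∀ O′ → IsOrdering O′ → α * S₊ O′ ≤ S₊ O

{-# OPTIONS --safe #-}

-- Write M for the value of the best sequence of length τ. Cut off the first
-- τ - 1 items A of a sequence L = A ++ B. The pairs inside B contribute
-- p_A S₊(B) ≤ b^(τ-1) S₊(B), and the pairs that meet A contribute at most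
-- M (1 + b^(τ+1) / (a^τ (1 - b))): those involving only A and the first item of
-- B sum to the value of a sequence of length τ, while for every later item y
-- optimality of M gives a^τ d(y, A) ≤ M, and the probabilities of reaching the
-- later items are dominated by a geometric series. Induction on the length of L
-- sums a second geometric series, of ratio b^(τ-1), and yields the denominator
-- 1 - b^(τ-1).

module Submission where

open import Defs
open import Data.Nat.Base as ℕ using (ℕ; zero; suc; _∸_; z≤n; s≤s)
open import Data.Fin.Base using (Fin)
open import Data.List.Base using (List; []; _∷_; [_]; _++_; _∷ʳ_; length; take)
open import Data.Product.Base using (_×_; _,_; proj₁; proj₂; ∃-syntax)

open import Algebra.Bundles using (CommutativeRing)
import Algebra.Apartness.Properties.HeytingCommutativeRing as HeytingProperties
import Algebra.Properties.Group as GroupProperties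
import Algebra.Properties.Ring as RingProperties
import Algebra.Solver.Ring.NaturalCoefficients.Default as SemiringSolver
open import Data.List.Properties
  using (++-assoc; ∷ʳ-++; length-++; length-++-≤ʳ; length-take; length-tabulate; ++-identityʳ)
open import Data.List.Membership.Propositional using (_∈_)
open import Data.List.Relation.Binary.Permutation.Propositional
  using (↭-sym; ↭-trans; ↭-reflexive; ↭⇒↭ₛ)
open import Data.List.Relation.Binary.Permutation.Propositional.Properties
  using (++-comm; ↭-length)
import Data.List.Relation.Binary.Permutation.Setoid.Properties as Permutation
open import Data.List.Relation.Binary.Sublist.Propositional
  using (_⊆_; []; _∷_; ⊆-refl; from∈) renaming (_∷ʳ_ to skip)
open import Data.List.Relation.Binary.Sublist.Propositional.Properties
  using (All-resp-⊆; ++⁺; ++⁺ʳ; take-⊆)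
open import Data.List.Relation.Unary.All as All using (All; []; _∷_)
open import Data.List.Relation.Unary.AllPairs using (AllPairs; []; _∷_)
open import Data.List.Relation.Unary.Any using (here; there)
open import Data.List.Relation.Unary.Unique.Propositional.Properties using (allFin⁺)
import Data.Nat.Properties as ℕ
open import Data.Sum.Base using (_⊎_; inj₁; inj₂)
open import Function.Bundles using (Equivalence)
open import Relation.Binary.PropositionalEquality as ≡ using (_≡_)
open import Relation.Binary.Structures using (IsPreorder)
import Relation.Binary.Reasoning.Base.Triple as Triple
open import Relation.Nullary.Negation using (contradiction)

-- Sublists and splitting of lists.

module _ {a} {A : Set a} where

  -- Needed for `Unique`, so that a sublist of an ordering competes with the best sequence.
  AllPairs-resp-⊆ : ∀ {ℓ} {R : A → A → Set ℓ} {xs ys} →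
                    xs ⊆ ys → AllPairs R ys → AllPairs R xs
  AllPairs-resp-⊆ []             []         = []
  AllPairs-resp-⊆ (skip _ xs⊆)   (_  ∷ pys) = AllPairs-resp-⊆ xs⊆ pys
  AllPairs-resp-⊆ (≡.refl ∷ xs⊆) (py ∷ pys) = All-resp-⊆ xs⊆ py ∷ AllPairs-resp-⊆ xs⊆ pys

  length-∷ʳ : ∀ (xs : List A) x → length (xs ∷ʳ x) ≡ suc (length xs)
  length-∷ʳ xs x = ≡.trans (length-++ xs) (ℕ.+-comm (length xs) 1)

  -- Drives the recursion with `m` equal to τ - 1: in the second case the item `z` completes `ys` to
  -- a sequence of length τ.
  short-or-split : ∀ m (xs : List A) → length xs ℕ.≤ m ⊎
                   ∃[ ys ] ∃[ z ] ∃[ zs ] (xs ≡ ys ++ z ∷ zs × length ys ≡ m)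
  short-or-split m       []       = inj₁ z≤n
  short-or-split zero    (x ∷ xs) = inj₂ ([] , x , xs , ≡.refl , ≡.refl)
  short-or-split (suc m) (x ∷ xs) with short-or-split m xs
  ... | inj₁ short                         = inj₁ (s≤s short)
  ... | inj₂ (ys , z , zs , ≡.refl , |ys|) = inj₂ (x ∷ ys , z , zs , ≡.refl , ≡.cong suc |ys|)

-- Order and arithmetic in an ordered field without decidable comparison.

module OrderedFieldProperties {c ℓ₁ ℓ₂} (F : OrderedField c ℓ₁ ℓ₂) where
  open OrderedField F
  open CommutativeRing commutativeRing using (+-group; commutativeSemiring)
  open GroupProperties +-group using (\\-leftDividesˡ; \\-leftDividesʳ; //-rightDividesˡ)
  open RingProperties ring using (x[y-z]≈xy-xz)
  open HeytingProperties heytingCommutativeRing using (x-0≈x; invertibleˡ⇒#)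
  open SemiringSolver commutativeSemiring using (solve; _:=_; _:+_; _:*_)

  <⇒≤ : ∀ {x y} → x < y → x ≤ y
  <⇒≤ x<y y<x = <-irrefl refl (<-trans x<y y<x)

  -- Apartness puts `z` apart from `x` or from `y`. When the apartness points the other way,
  -- transitivity with `x < y` gives the other alternative. This takes the place of trichotomy.
  <-cotrans : ∀ {x y} → x < y → ∀ z → x < z ⊎ z < y
  <-cotrans {x} {y} x<y z with #-cotrans (Equivalence.from (#⇔<⊎> x y) (inj₁ x<y)) z
  ... | inj₁ x#z with Equivalence.to (#⇔<⊎> x z) x#z
  ...   | inj₁ x<z = inj₁ x<z
  ...   | inj₂ z<x = inj₂ (<-trans z<x x<y)
  <-cotrans {x} {y} x<y z | inj₂ z#y with Equivalence.to (#⇔<⊎> z y) z#y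
  ...   | inj₁ z<y = inj₂ z<y
  ...   | inj₂ y<z = inj₁ (<-trans x<y y<z)

  ≤-trans : ∀ {x y z} → x ≤ y → y ≤ z → x ≤ z
  ≤-trans {y = y} x≤y y≤z z<x with <-cotrans z<x y
  ... | inj₁ z<y = y≤z z<y
  ... | inj₂ y<x = x≤y y<x

  <-≤-trans : ∀ {x y z} → x < y → y ≤ z → x < z
  <-≤-trans {z = z} x<y y≤z with <-cotrans x<y z
  ... | inj₁ x<z = x<z
  ... | inj₂ z<y = contradiction z<y y≤z

  ≤-<-trans : ∀ {x y z} → x ≤ y → y < z → x < z
  ≤-<-trans {x = x} x≤y y<z with <-cotrans y<z x
  ... | inj₁ y<x = contradiction y<x x≤y
  ... | inj₂ x<z = x<z

  ≤-reflexive : ∀ {x y} → x ≈ y → x ≤ y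
  ≤-reflexive x≈y y<x = <-irrefl (sym x≈y) y<x

  ≤-refl : ∀ {x} → x ≤ x
  ≤-refl = ≤-reflexive refl

  ≤-isPreorder : IsPreorder _≈_ _≤_
  ≤-isPreorder = record
    { isEquivalence = isEquivalence
    ; reflexive     = ≤-reflexive
    ; trans         = ≤-trans
    }

  module ≤-Reasoning = Triple ≤-isPreorder <⇒≤ <-trans
    (<-respʳ-≈ , <-respˡ-≈) <⇒≤ <-≤-trans ≤-<-trans

  x<y⇒0<y-x : ∀ {x y} → x < y → 0# < y - x
  x<y⇒0<y-x {x} {y} x<y =
    <-respˡ-≈ (-‿inverseˡ x) (<-respʳ-≈ (+-comm (- x) y) (+-monoʳ-< (- x) x<y))

  0<y-x⇒x<y : ∀ {x y} → 0# < y - x → x < y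
  0<y-x⇒x<y {x} {y} 0<y-x = <-respˡ-≈ (+-identityʳ x) (<-respʳ-≈ x+[y-x]≈y (+-monoʳ-< x 0<y-x))
    where
    x+[y-x]≈y : x + (y - x) ≈ y
    x+[y-x]≈y = trans (+-congˡ (+-comm y (- x))) (\\-leftDividesˡ x y)

  1-x+x≈1 : ∀ x → (1# - x) + x ≈ 1#
  1-x+x≈1 x = //-rightDividesˡ x 1#

  +-monoʳ-≤ : ∀ z {x y} → x ≤ y → z + x ≤ z + y
  +-monoʳ-≤ z {x} {y} x≤y z+y<z+x = x≤y
    (<-respˡ-≈ (\\-leftDividesʳ z y) (<-respʳ-≈ (\\-leftDividesʳ z x) (+-monoʳ-< (- z) z+y<z+x)))

  x≤y⇒0≤y-x : ∀ {x y} → x ≤ y → 0# ≤ y - x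
  x≤y⇒0≤y-x {x} {y} x≤y = begin
    0#      ≈⟨ -‿inverseˡ x ⟨
    - x + x ≤⟨ +-monoʳ-≤ (- x) x≤y ⟩
    - x + y ≈⟨ +-comm (- x) y ⟩
    y - x   ∎
    where open ≤-Reasoning

  +-mono-≤ : ∀ {w x y z} → w ≤ x → y ≤ z → w + y ≤ x + z
  +-mono-≤ {w} {x} {y} {z} w≤x y≤z = begin
    w + y ≈⟨ +-comm w y ⟩
    y + w ≤⟨ +-monoʳ-≤ y w≤x ⟩
    y + x ≈⟨ +-comm y x ⟩
    x + y ≤⟨ +-monoʳ-≤ x y≤z ⟩
    x + z ∎
    where open ≤-Reasoning

  0≤x⇒y≤y+x : ∀ {x} → 0# ≤ x → ∀ y → y ≤ y + x
  0≤x⇒y≤y+x 0≤x y = ≤-trans (≤-reflexive (sym (+-identityʳ y))) (+-monoʳ-≤ y 0≤x)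

  0≤x⇒y≤x+y : ∀ {x} → 0# ≤ x → ∀ y → y ≤ x + y
  0≤x⇒y≤x+y {x} 0≤x y = ≤-trans (0≤x⇒y≤y+x 0≤x y) (≤-reflexive (+-comm y x))

  +-nonNegative : ∀ {x y} → 0# ≤ x → 0# ≤ y → 0# ≤ x + y
  +-nonNegative 0≤x 0≤y = ≤-trans 0≤x (0≤x⇒y≤y+x 0≤y _)

  *-monoʳ-< : ∀ {z} → 0# < z → ∀ {x y} → x < y → z * x < z * y
  *-monoʳ-< {z} 0<z {x} {y} x<y =
    0<y-x⇒x<y (<-respʳ-≈ (x[y-z]≈xy-xz z y x) (*-positive 0<z (x<y⇒0<y-x x<y)))

  -- An inverse of `z * (x - y)`, multiplied by either factor, is an inverse of the other one.
  *-reflects-# : ∀ {x y z} → z * x # z * y → z # 0# × x # y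
  *-reflects-# {x} {y} {z} zx#zy with #⇒invertible zx#zy
  ... | i , i*[zx-zy]≈1 , _ =
    invertibleˡ⇒# (i * (x - y) , trans (*-congˡ (x-0≈x z)) (trans
      (solve 3 (λ i w z → i :* w :* z := i :* (z :* w)) refl i (x - y) z) i*z[x-y]≈1)) ,
    invertibleˡ⇒# (i * z , trans (*-assoc i z (x - y)) i*z[x-y]≈1)
    where
    i*z[x-y]≈1 : i * (z * (x - y)) ≈ 1#
    i*z[x-y]≈1 = trans (*-congˡ (x[y-z]≈xy-xz z x y)) i*[zx-zy]≈1

  -- The goal is a negation, so `z * y < z * x` may be assumed. It makes `z` apart from zero and `y`
  -- apart from `x`, and each of the resulting sign cases is contradictory.
  *-monoʳ-≤ : ∀ {z} → 0# ≤ z → ∀ {x y} → x ≤ y → z * x ≤ z * y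
  *-monoʳ-≤ {z} 0≤z {x} {y} x≤y zy<zx
    with *-reflects-# (Equivalence.from (#⇔<⊎> _ _) (inj₁ zy<zx))
  ... | z#0 , y#x with Equivalence.to (#⇔<⊎> _ _) z#0 | Equivalence.to (#⇔<⊎> _ _) y#x
  ...   | inj₁ z<0 | _        = 0≤z z<0
  ...   | inj₂ _   | inj₁ y<x = x≤y y<x
  ...   | inj₂ 0<z | inj₂ x<y = <⇒≤ (*-monoʳ-< 0<z x<y) zy<zx

  *-monoˡ-≤ : ∀ {z} → 0# ≤ z → ∀ {x y} → x ≤ y → x * z ≤ y * z
  *-monoˡ-≤ {z} 0≤z {x} {y} x≤y = begin
    x * z ≈⟨ *-comm x z ⟩
    z * x ≤⟨ *-monoʳ-≤ 0≤z x≤y ⟩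
    z * y ≈⟨ *-comm z y ⟩
    y * z ∎
    where open ≤-Reasoning

  *-nonNegative : ∀ {x y} → 0# ≤ x → 0# ≤ y → 0# ≤ x * y
  *-nonNegative {x} 0≤x 0≤y = ≤-trans (≤-reflexive (sym (zeroʳ x))) (*-monoʳ-≤ 0≤x 0≤y)

  *-mono-≤ : ∀ {w x y z} → 0# ≤ x → 0# ≤ y → w ≤ x → y ≤ z → w * y ≤ x * z
  *-mono-≤ 0≤x 0≤y w≤x y≤z = ≤-trans (*-monoˡ-≤ 0≤y w≤x) (*-monoʳ-≤ 0≤x y≤z)

  /-≤ : ∀ {N D} (D#0 : D # 0#) → 0# < D → ∀ {x y} → N * x ≤ D * y → N / D ⟨ D#0 ⟩ * x ≤ y
  /-≤ {N} {D} D#0 0<D {x} {y} Nx≤Dy y<αx = <-irrefl refl (begin-strict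
    D * y               <⟨ *-monoʳ-< 0<D y<αx ⟩
    D * (N * i * x)     ≈⟨ solve 4 (λ D N i x → D :* (N :* i :* x) := i :* D :* (N :* x)) refl D N i x ⟩
    i * D * (N * x)     ≈⟨ *-congʳ (trans (*-congˡ (sym (x-0≈x D))) i*[D-0]≈1) ⟩
    1# * (N * x)        ≈⟨ *-identityˡ (N * x) ⟩
    N * x               ≤⟨ Nx≤Dy ⟩
    D * y               ∎)
    where
    open ≤-Reasoning
    i = proj₁ (#⇒invertible D#0)
    i*[D-0]≈1 = proj₁ (proj₂ (#⇒invertible D#0))

-- Diversity of a concatenation.

module SequentialSumDiversity {c ℓ₁ ℓ₂} (F : OrderedField c ℓ₁ ℓ₂) where
  open OrderedField F
  open OrderedFieldProperties F
  open CommutativeRing commutativeRing using (commutativeSemiring)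
  open SemiringSolver commutativeSemiring using (solve; _:=_; _:+_; _:*_)

  module _ {n} (d : Fin n → Fin n → Carrier) (p : Fin n → Carrier) where
    open MaxSSD F d p
    open import Relation.Binary.Reasoning.Setoid setoid

    p[]-++ : ∀ xs ys → p[ xs ++ ys ] ≈ p[ xs ] * p[ ys ]
    p[]-++ []       ys = sym (*-identityˡ _)
    p[]-++ (x ∷ xs) ys = trans (*-congˡ (p[]-++ xs ys)) (sym (*-assoc _ _ _))

    d[]-++ : ∀ z xs ys → d[ z , xs ++ ys ] ≈ d[ z , xs ] + d[ z , ys ]
    d[]-++ z []       ys = sym (+-identityˡ _)
    d[]-++ z (x ∷ xs) ys = trans (+-congˡ (d[]-++ z xs ys)) (sym (+-assoc _ _ _))

    sumFrom-++ : ∀ ps xs ys → sumFrom ps (xs ++ ys) ≈ sumFrom ps xs + sumFrom (ps ++ xs) ys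
    sumFrom-++ ps []       ys =
      trans (sym (+-identityˡ _)) (+-congˡ (reflexive (≡.cong (λ zs → sumFrom zs ys) (≡.sym (++-identityʳ ps)))))
    sumFrom-++ ps (x ∷ xs) ys = begin
      term + sumFrom (ps ∷ʳ x) (xs ++ ys)
        ≈⟨ +-congˡ (sumFrom-++ (ps ∷ʳ x) xs ys) ⟩
      term + (sumFrom (ps ∷ʳ x) xs + sumFrom (ps ∷ʳ x ++ xs) ys)
        ≡⟨ ≡.cong (λ zs → term + (sumFrom (ps ∷ʳ x) xs + sumFrom zs ys)) (∷ʳ-++ ps x xs) ⟩
      term + (sumFrom (ps ∷ʳ x) xs + sumFrom (ps ++ x ∷ xs) ys)
        ≈⟨ +-assoc _ _ _ ⟨
      term + sumFrom (ps ∷ʳ x) xs + sumFrom (ps ++ x ∷ xs) ys ∎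
      where term = p[ ps ∷ʳ x ] * d[ x , ps ]

    -- The first item has an empty prefix and contributes zero. Hence the concatenation law of
    -- `sumFrom` carries over to `S₊`.
    S₊≈sumFrom[] : ∀ xs → S₊ xs ≈ sumFrom [] xs
    S₊≈sumFrom[] []       = refl
    S₊≈sumFrom[] (x ∷ xs) = sym (trans (+-congʳ (zeroʳ _)) (+-identityˡ _))

    S₊-++ : ∀ xs ys → S₊ (xs ++ ys) ≈ S₊ xs + sumFrom xs ys
    S₊-++ xs ys = begin
      S₊ (xs ++ ys)                 ≈⟨ S₊≈sumFrom[] (xs ++ ys) ⟩
      sumFrom [] (xs ++ ys)         ≈⟨ sumFrom-++ [] xs ys ⟩
      sumFrom [] xs + sumFrom xs ys ≈⟨ +-congʳ (S₊≈sumFrom[] xs) ⟨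
      S₊ xs + sumFrom xs ys         ∎

  -- Estimates from the bounds on the continuation probabilities.

  module Bounds {n} (d : Fin n → Fin n → Carrier) (p : Fin n → Carrier) {a b}
    (isDistance : IsDistance F d) (0<a : 0# < a) (a≤b : a ≤ b) (b<1 : b < 1#)
    (p∈[a,b] : ∀ i → a ≤ p i × p i ≤ b) where

    open MaxSSD F d p
    open IsDistance isDistance
    open ≤-Reasoning

    0<b : 0# < b
    0<b = <-≤-trans 0<a a≤b

    0<1 : 0# < 1#
    0<1 = <-trans 0<b b<1

    0≤pᵢ : ∀ i → 0# ≤ p i
    0≤pᵢ i = ≤-trans (<⇒≤ 0<a) (proj₁ (p∈[a,b] i))

    0<1-b : 0# < 1# - b
    0<1-b = x<y⇒0<y-x b<1

    ^-positive : ∀ {x} → 0# < x → ∀ k → 0# < x ^ k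
    ^-positive 0<x zero    = 0<1
    ^-positive 0<x (suc k) = *-positive 0<x (^-positive 0<x k)

    b^k≤1 : ∀ k → b ^ k ≤ 1#
    b^k≤1 zero    = ≤-refl
    b^k≤1 (suc k) = begin
      b * b ^ k ≤⟨ *-mono-≤ (<⇒≤ 0<1) (<⇒≤ (^-positive 0<b k)) (<⇒≤ b<1) (b^k≤1 k) ⟩
      1# * 1#   ≈⟨ *-identityˡ 1# ⟩
      1#        ∎

    p[]-nonNegative : ∀ xs → 0# ≤ p[ xs ]
    p[]-nonNegative []       = <⇒≤ 0<1
    p[]-nonNegative (x ∷ xs) = *-nonNegative (0≤pᵢ x) (p[]-nonNegative xs)

    d[]-nonNegative : ∀ y xs → 0# ≤ d[ y , xs ]
    d[]-nonNegative y []       = ≤-refl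
    d[]-nonNegative y (x ∷ xs) = +-nonNegative (nonNegative y x) (d[]-nonNegative y xs)

    a^k≤p[] : ∀ xs → a ^ length xs ≤ p[ xs ]
    a^k≤p[] []       = ≤-refl
    a^k≤p[] (x ∷ xs) =
      *-mono-≤ (0≤pᵢ x) (<⇒≤ (^-positive 0<a (length xs))) (proj₁ (p∈[a,b] x)) (a^k≤p[] xs)

    p[]≤b^k : ∀ xs → p[ xs ] ≤ b ^ length xs
    p[]≤b^k []       = ≤-refl
    p[]≤b^k (x ∷ xs) =
      *-mono-≤ (<⇒≤ 0<b) (p[]-nonNegative xs) (proj₂ (p∈[a,b] x)) (p[]≤b^k xs)

    sumFrom-nonNegative : ∀ ps xs → 0# ≤ sumFrom ps xs
    sumFrom-nonNegative ps []       = ≤-refl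
    sumFrom-nonNegative ps (x ∷ xs) = +-nonNegative
      (*-nonNegative (p[]-nonNegative (ps ∷ʳ x)) (d[]-nonNegative x ps))
      (sumFrom-nonNegative (ps ∷ʳ x) xs)

    S₊-nonNegative : ∀ xs → 0# ≤ S₊ xs
    S₊-nonNegative []       = ≤-refl
    S₊-nonNegative (x ∷ xs) = sumFrom-nonNegative [ x ] xs

    S₊-prefix : ∀ xs ys → S₊ xs ≤ S₊ (xs ++ ys)
    S₊-prefix xs ys = begin
      S₊ xs                 ≤⟨ 0≤x⇒y≤y+x (sumFrom-nonNegative xs ys) (S₊ xs) ⟩
      S₊ xs + sumFrom xs ys ≈⟨ S₊-++ d p xs ys ⟨
      S₊ (xs ++ ys)         ∎

    -- The last term of `S₊ (xs ∷ʳ y)` alone suffices, its probability being at least a power of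
    -- `a`. This is how a bound on diversity becomes a bound on distances, and where a^τ comes from.
    a^k*d[]≤S₊ : ∀ xs y → a ^ suc (length xs) * d[ y , xs ] ≤ S₊ (xs ∷ʳ y)
    a^k*d[]≤S₊ xs y = begin
      a ^ suc (length xs) * d[ y , xs ]               ≡⟨ ≡.cong (λ k → a ^ k * d[ y , xs ]) (length-∷ʳ xs y) ⟨
      a ^ length (xs ∷ʳ y) * d[ y , xs ]              ≤⟨ *-monoˡ-≤ (d[]-nonNegative y xs) (a^k≤p[] (xs ∷ʳ y)) ⟩
      p[ xs ∷ʳ y ] * d[ y , xs ]                      ≈⟨ +-identityʳ _ ⟨
      sumFrom xs [ y ]                                ≤⟨ 0≤x⇒y≤x+y (S₊-nonNegative xs) _ ⟩
      S₊ xs + sumFrom xs [ y ]                        ≈⟨ S₊-++ d p xs [ y ] ⟨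
      S₊ (xs ∷ʳ y)                                    ∎

    -- The pairs joining xs to zs cost at most the geometric series
    -- Σ_{k > |xs ++ ys|} b^k M = b^(|xs ++ ys| + 1) M / (1 - b).
    sumFrom-detach : ∀ {r M} → 0# ≤ r → 0# ≤ M → ∀ xs ys zs →
                     All (λ z → r * d[ z , xs ] ≤ M) zs →
                     r * (1# - b) * sumFrom (xs ++ ys) zs ≤
                     b ^ suc (length (xs ++ ys)) * M + r * (1# - b) * (p[ xs ] * sumFrom ys zs)
    sumFrom-detach {r} {M} 0≤r 0≤M xs ys [] _ = begin
      r * (1# - b) * 0#                               ≈⟨ zeroʳ _ ⟩
      0#                                              ≤⟨ *-nonNegative (<⇒≤ (^-positive 0<b (suc (length (xs ++ ys))))) 0≤M ⟩
      b ^ suc (length (xs ++ ys)) * M                 ≈⟨ +-identityʳ _ ⟨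
      b ^ suc (length (xs ++ ys)) * M + 0#            ≈⟨ +-congˡ (trans (*-congˡ (zeroʳ _)) (zeroʳ _)) ⟨
      b ^ suc (length (xs ++ ys)) * M + r * (1# - b) * (p[ xs ] * 0#) ∎
    sumFrom-detach {r} {M} 0≤r 0≤M xs ys (z ∷ zs) (rd≤M ∷ rds≤M) = begin
      r * w * (π * d[ z , xs ++ ys ] + s)
        ≈⟨ *-congˡ (+-congʳ (*-congˡ (d[]-++ d p z xs ys))) ⟩
      r * w * (π * (u + v) + s)
        ≈⟨ solve 6 (λ r w π u v s → r :* w :* (π :* (u :+ v) :+ s)
             := π :* (w :* (r :* u)) :+ (r :* w :* (π :* v) :+ r :* w :* s)) refl r w π u v s ⟩
      π * (w * (r * u)) + (r * w * (π * v) + r * w * s)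
        -- Only the share of `u`, the distance to `xs`, is estimated. The share of `v` is kept
        -- exactly: once `p[ xs ]` is factored out of `π`, it is the term of `z` in `sumFrom ys`.
        ≤⟨ +-mono-≤
             (*-mono-≤ (<⇒≤ (^-positive 0<b (suc k))) (*-nonNegative 0≤w (*-nonNegative 0≤r (d[]-nonNegative z xs)))
               π≤β (*-monoʳ-≤ 0≤w rd≤M))
             (+-monoʳ-≤ _ ih) ⟩
      β * (w * M) + (r * w * (π * v) + (b * β * M + r * w * (p[ xs ] * s′)))
        ≈⟨ +-congˡ (+-congʳ (*-congˡ (*-congʳ π≈))) ⟩
      β * (w * M) + (r * w * (p[ xs ] * π′ * v) + (b * β * M + r * w * (p[ xs ] * s′)))
        ≈⟨ solve 9 (λ β w M r q π′ v b s′ →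
             β :* (w :* M) :+ (r :* w :* (q :* π′ :* v) :+ (b :* β :* M :+ r :* w :* (q :* s′)))
             := (w :+ b) :* (β :* M) :+ r :* w :* (q :* (π′ :* v :+ s′)))
             refl β w M r p[ xs ] π′ v b s′ ⟩
      (w + b) * (β * M) + r * w * (p[ xs ] * (π′ * v + s′))
        -- The geometric series closes up: the share `w` of this item and the share `b` of all later
        -- ones add up to one.
        ≈⟨ +-congʳ (trans (*-congʳ (1-x+x≈1 b)) (*-identityˡ _)) ⟩
      β * M + r * w * (p[ xs ] * (π′ * v + s′)) ∎
      where
      k = length (xs ++ ys)
      w = 1# - b
      β = b ^ suc k
      u = d[ z , xs ]
      v = d[ z , ys ]
      π = p[ (xs ++ ys) ∷ʳ z ]
      π′ = p[ ys ∷ʳ z ]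
      s = sumFrom ((xs ++ ys) ∷ʳ z) zs
      s′ = sumFrom (ys ∷ʳ z) zs

      0≤w : 0# ≤ w
      0≤w = <⇒≤ 0<1-b

      π≤β : π ≤ β
      π≤β = ≡.subst (λ k → π ≤ b ^ k) (length-∷ʳ (xs ++ ys) z) (p[]≤b^k ((xs ++ ys) ∷ʳ z))

      π≈ : π ≈ p[ xs ] * π′
      π≈ = trans (reflexive (≡.cong p[_] (++-assoc xs ys [ z ]))) (p[]-++ d p xs (ys ∷ʳ z))

      ih : r * w * s ≤ b * β * M + r * w * (p[ xs ] * s′)
      ih = begin
        r * w * s
          ≡⟨ ≡.cong (λ ps → r * w * sumFrom ps zs) (++-assoc xs ys [ z ]) ⟩
        r * w * sumFrom (xs ++ ys ∷ʳ z) zs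
          ≤⟨ sumFrom-detach 0≤r 0≤M xs (ys ∷ʳ z) zs rds≤M ⟩
        b ^ suc (length (xs ++ ys ∷ʳ z)) * M + r * w * (p[ xs ] * s′)
          ≡⟨ ≡.cong (λ k → b ^ suc k * M + r * w * (p[ xs ] * s′))
               (≡.trans (≡.cong length (≡.sym (++-assoc xs ys [ z ]))) (length-∷ʳ (xs ++ ys) z)) ⟩
        b * β * M + r * w * (p[ xs ] * s′) ∎

    -- Comparison with a best sequence.

    module _ {m s} (2+m≤n : suc (suc m) ℕ.≤ n) (best : IsBestSequence (suc (suc m)) s) where

      private
        τ = suc (suc m)
        M = S₊ s
        -- The factor 1 + b^(τ+1) / (a^τ (1 - b)) is `D` over `e`. Inequalities are stated
        -- multiplied through by `e`, so no division occurs until the end.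
        e = a ^ τ * (1# - b)
        q = b ^ suc m
        D = e + b ^ suc τ

        0≤e : 0# ≤ e
        0≤e = <⇒≤ (*-positive (^-positive 0<a τ) 0<1-b)

        0≤D : 0# ≤ D
        0≤D = +-nonNegative 0≤e (<⇒≤ (^-positive 0<b (suc τ)))

        0≤1-q : 0# ≤ 1# - q
        0≤1-q = x≤y⇒0≤y-x (b^k≤1 (suc m))

        1-q≤1 : 1# - q ≤ 1#
        1-q≤1 = ≤-trans (0≤x⇒y≤y+x (<⇒≤ (^-positive 0<b (suc m))) _) (≤-reflexive (1-x+x≈1 q))

      -- Being free of duplicates passes from `allFin n` to its permutation `O` and on to the
      -- sublist `t`, which is therefore a competitor of `s`.
      S₊-sublist≤M : ∀ {t O} → IsOrdering O → t ⊆ O → length t ≡ τ → S₊ t ≤ M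
      S₊-sublist≤M O↭U t⊆O |t|≡τ = proj₂ best _ (|t|≡τ , AllPairs-resp-⊆ t⊆O
        (Permutation.Unique-resp-↭ (≡.setoid (Fin n)) (↭⇒↭ₛ (↭-sym O↭U)) (allFin⁺ n)))

      -- Padding `L` with items of `P` up to length τ does not decrease the value. There are enough
      -- items because τ is at most n.
      S₊-short≤M : ∀ L P → IsOrdering (L ++ P) → length L ℕ.≤ τ → S₊ L ≤ M
      S₊-short≤M L P L++P↭U |L|≤τ = ≤-trans (S₊-prefix L (take (τ ∸ length L) P))
        (S₊-sublist≤M L++P↭U (++⁺ ⊆-refl (take-⊆ (τ ∸ length L) P)) |L++take|≡τ)
        where
        |L|+|P|≡n : length L ℕ.+ length P ≡ n
        |L|+|P|≡n = ≡.trans (≡.sym (length-++ L)) (≡.trans (↭-length L++P↭U) (length-tabulate _))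

        |L++take|≡τ : length (L ++ take (τ ∸ length L) P) ≡ τ
        |L++take|≡τ = ≡.trans (length-++ L) (≡.trans
          (≡.cong (length L ℕ.+_) (≡.trans (length-take (τ ∸ length L) P) (ℕ.m≤n⇒m⊓n≡m
            (ℕ.m≤n+o⇒m∸n≤o τ (length L) (≡.subst (τ ℕ.≤_) (≡.sym |L|+|P|≡n) 2+m≤n)))))
          (ℕ.m+[n∸m]≡n |L|≤τ))

      -- The sequence `A ∷ʳ x` has length τ, so its value is at most `M`. The later items are
      -- detached from `A`, while their pairs with `x` and with each other remain in `S₊ (x ∷ B)`.
      e*S₊-split : ∀ A x B P → length A ≡ suc m → IsOrdering ((A ++ x ∷ B) ++ P) →
                   e * S₊ (A ++ x ∷ B) ≤ D * M + e * (p[ A ] * S₊ (x ∷ B))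
      e*S₊-split A x B P |A|≡ AxBP↭U = begin
        e * S₊ (A ++ x ∷ B)
          ≡⟨ ≡.cong (λ L → e * S₊ L) (∷ʳ-++ A x B) ⟨
        e * S₊ (A ∷ʳ x ++ B)
          ≈⟨ *-congˡ (S₊-++ d p (A ∷ʳ x) B) ⟩
        e * (S₊ (A ∷ʳ x) + sumFrom (A ∷ʳ x) B)
          ≈⟨ distribˡ _ _ _ ⟩
        e * S₊ (A ∷ʳ x) + e * sumFrom (A ∷ʳ x) B
          ≤⟨ +-mono-≤ (*-monoʳ-≤ 0≤e (head≤M (here ≡.refl))) tail≤ ⟩
        e * M + (b ^ suc τ * M + e * (p[ A ] * S₊ (x ∷ B)))
          ≈⟨ solve 4 (λ e M β r → e :* M :+ (β :* M :+ r) := (e :+ β) :* M :+ r) refl e M (b ^ suc τ) _ ⟩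
        D * M + e * (p[ A ] * S₊ (x ∷ B)) ∎
        where
        head≤M : ∀ {y} → y ∈ x ∷ B → S₊ (A ∷ʳ y) ≤ M
        head≤M {y} y∈ = S₊-sublist≤M AxBP↭U (++⁺ʳ P (++⁺ (⊆-refl {x = A}) (from∈ y∈)))
          (≡.trans (length-∷ʳ A y) (≡.cong suc |A|≡))

        tail≤ : e * sumFrom (A ∷ʳ x) B ≤ b ^ suc τ * M + e * (p[ A ] * sumFrom [ x ] B)
        tail≤ = ≡.subst
          (λ k → e * sumFrom (A ∷ʳ x) B ≤ b ^ suc k * M + e * (p[ A ] * sumFrom [ x ] B))
          (≡.trans (length-∷ʳ A x) (≡.cong suc |A|≡))
          (sumFrom-detach (<⇒≤ (^-positive 0<a τ)) (S₊-nonNegative s) A [ x ] B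
            -- For `y` in `B`, the sequence `A ∷ʳ y` is also a competitor of `s`, which bounds the
            -- distance from `y` to `A`.
            (All.tabulate λ {y} y∈B → ≡.subst (λ k → a ^ suc k * d[ y , A ] ≤ M) |A|≡
              (≤-trans (a^k*d[]≤S₊ A y) (head≤M (there y∈B)))))

      -- The bound reproduces itself: cutting off `A` costs at most (1 - q) D M, and the rest,
      -- weighted by `p[ A ] ≤ q`, at most q D M. The list `P` holds the items outside `L`, so that
      -- `L ++ P` stays an ordering; `k` bounds the length for the induction.
      e[1-q]*S₊≤D*M : ∀ k L P → length L ℕ.≤ k → IsOrdering (L ++ P) →
                      e * (1# - q) * S₊ L ≤ D * M
      e[1-q]*S₊≤D*M k L P |L|≤k LP↭U with short-or-split (suc m) L
      ... | inj₁ |L|≤1+m = *-mono-≤ 0≤D (S₊-nonNegative L)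
        (begin
          e * (1# - q)  ≤⟨ *-monoʳ-≤ 0≤e 1-q≤1 ⟩
          e * 1#        ≈⟨ *-identityʳ e ⟩
          e             ≤⟨ 0≤x⇒y≤y+x (<⇒≤ (^-positive 0<b (suc τ))) e ⟩
          D             ∎)
        (S₊-short≤M L P LP↭U (ℕ.m≤n⇒m≤1+n |L|≤1+m))
      -- The cut-off piece has `suc m` items, so it is nonempty. This rules out `k` being zero here
      -- and makes the remainder strictly shorter in the next clause.
      e[1-q]*S₊≤D*M zero    _ P () LP↭U | inj₂ (_ ∷ _ , _ , _ , ≡.refl , _)
      e[1-q]*S₊≤D*M (suc k) _ P (s≤s |L|≤k) LP↭U | inj₂ (A@(_ ∷ A′) , x , B , ≡.refl , |A|≡) = begin
        e * (1# - q) * S₊ (A ++ x ∷ B)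
          ≈⟨ solve 3 (λ e w S → e :* w :* S := w :* (e :* S)) refl e (1# - q) _ ⟩
        (1# - q) * (e * S₊ (A ++ x ∷ B))
          ≤⟨ *-monoʳ-≤ 0≤1-q (e*S₊-split A x B P |A|≡ LP↭U) ⟩
        (1# - q) * (D * M + e * (p[ A ] * S₊ (x ∷ B)))
          ≈⟨ solve 5 (λ w N e π S → w :* (N :+ e :* (π :* S)) := w :* N :+ π :* (e :* w :* S))
               refl (1# - q) (D * M) e p[ A ] _ ⟩
        (1# - q) * (D * M) + p[ A ] * (e * (1# - q) * S₊ (x ∷ B))
          ≤⟨ +-monoʳ-≤ _ (*-monoʳ-≤ (p[]-nonNegative A)
               (e[1-q]*S₊≤D*M k (x ∷ B) (P ++ A) (ℕ.≤-trans (length-++-≤ʳ (x ∷ B) {A′}) |L|≤k) xBPA↭U)) ⟩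
        (1# - q) * (D * M) + p[ A ] * (D * M)
          ≤⟨ +-monoʳ-≤ _ (*-monoˡ-≤ (*-nonNegative 0≤D (S₊-nonNegative s)) p[A]≤q) ⟩
        (1# - q) * (D * M) + q * (D * M)
          ≈⟨ distribʳ (D * M) (1# - q) q ⟨
        ((1# - q) + q) * (D * M)
          ≈⟨ trans (*-congʳ (1-x+x≈1 q)) (*-identityˡ _) ⟩
        D * M ∎
        where
        p[A]≤q : p[ A ] ≤ q
        p[A]≤q = ≡.subst (λ k → p[ A ] ≤ b ^ k) |A|≡ (p[]≤b^k A)

        xBPA↭U : IsOrdering ((x ∷ B) ++ (P ++ A))
        xBPA↭U = ↭-trans (↭-reflexive (≡.sym (++-assoc (x ∷ B) P A)))
          (↭-trans (++-comm ((x ∷ B) ++ P) A)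
          (↭-trans (↭-reflexive (≡.sym (++-assoc A (x ∷ B) P))) LP↭U))

theorem8p2 : ∀ {c ℓ₁ ℓ₂} (F : OrderedField c ℓ₁ ℓ₂) → let open OrderedField F in
    ∀ (n : ℕ) (d : Fin n → Fin n → Carrier) (p : Fin n → Carrier) (a b : Carrier) →
    IsDistance F d →
    (0<a : 0# < a) (a≤b : a ≤ b) (b<1 : b < 1#) →
    (∀ i → a ≤ p i × p i ≤ b) →
    ∀ (τ : ℕ) → 2 ℕ.≤ τ → τ ℕ.≤ n →
    let open MaxSSD F d p in
    ∀ (O : List (Fin n)) → SBτIOutput τ O →
    IsApproximation
    ((a ^ τ * (1# - b) * (1# - b ^ (τ ∸ 1))) / (a ^ τ * (1# - b) + b ^ (τ ℕ.+ 1)) ⟨ denominator#0 F 0<a a≤b b<1 τ ⟩)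
    O
theorem8p2 F n d p a b isDistance 0<a a≤b b<1 p∈[a,b] τ@(suc (suc m)) (s≤s (s≤s z≤n)) τ≤n
  _ (_ , s , rest , ≡.refl , best) O′ O′↭U =
  /-≤ (denominator#0 F 0<a a≤b b<1 τ) 0<D (begin
    N * S₊ O′                 ≤⟨ e[1-q]*S₊≤D*M τ≤n best (length O′) O′ [] ℕ.≤-refl
                                   (↭-trans (↭-reflexive (++-identityʳ O′)) O′↭U) ⟩
    (e + b ^ suc τ) * S₊ s    ≡⟨ ≡.cong (λ k → (e + b ^ k) * S₊ s) (ℕ.+-comm τ 1) ⟨
    -- The appended items, in whatever order, only add nonnegative terms.
    D * S₊ s                  ≤⟨ *-monoʳ-≤ (<⇒≤ 0<D) (S₊-prefix s rest) ⟩
    D * S₊ (s ++ rest)        ∎)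
  where
  open OrderedField F
  open OrderedFieldProperties F
  open ≤-Reasoning
  open MaxSSD F d p
  open SequentialSumDiversity F
  open Bounds d p isDistance 0<a a≤b b<1 p∈[a,b]
  e = a ^ τ * (1# - b)
  N = e * (1# - b ^ (τ ∸ 1))
  D = e + b ^ (τ ℕ.+ 1)

  0<D : 0# < D
  0<D = <-≤-trans (*-positive (^-positive 0<a τ) 0<1-b)
    (0≤x⇒y≤y+x (<⇒≤ (^-positive 0<b (τ ℕ.+ 1))) e)
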